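{- Let $G=\prod_{i=1}^n K[u_i,t_i]$ be a direct product of balanced complete multipartite graphs, where $u_i,t_i$ are positive integers. Suppose $G$ is not isomorphic to any of the following $37$ graphs: $K_3^4$, $K[2,3]\times K_3^3$, $K[3,3]\times K_3^3$, $K_4\times K_3^3$, $K[2,4]\times K_3^3$, $K_4\times K[2,3]\times K_3^2$, $K_4^2\times K_3^2$, $K[2,4]\times K_4\times K_3^2$, $K_4^2\times K[2,3]\times K_3$, $K_4^3\times K_3$, $K_5\times K_3^3$, $K[2,5]\times K_3^3$, $K_5\times K[2,3]\times K_3^2$, $K_5\times K_4\times K_3^2$, $K_5\times K_4^2\times K_3$, $K_5^2\times K_3^2$, $K_6\times K_3^3$, $K_6\times K_4\times K_3^2$, $K_6\times K_4^2\times K_3$, $K_6\times K_5\times K_3^2$, $K_7\times K_3^3$, $K_7\times K_4\times K_3^2$, $K_8\times K_3^3$, $K_8\times K_4\times K_3^2$, $K_9\times K_3^3$, $K_{10}\times K_3^3$, $K_3^5$, $K[2,3]\times K_3^4$, $K_4\times K_3^4$, $K_4^2\times K_3^3$, $K_4^3\times K_3^2$, $K_5\times K_3^4$, $K_5\times K_4\times K_3^3$, $K_6\times K_3^4$, $K_7\times K_3^4$, $K_3^6$, $K_4\times K_3^5$. Then $\alpha(G)=\mathrm{IR}(G)$.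
   Context: All graphs are simple. The direct product $G_1\times\cdots\times G_n$ has vertex set $V(G_1)\times\cdots\times V(G_n)$, with $(g_1,\ldots,g_n)$ adjacent to $(g_1',\ldots,g_n')$ iff $g_i$ is adjacent to $g_i'$ in $G_i$ for every $i$. $K[u,t]$ denotes the complete multipartite graph with $t$ partite sets each of size $u$; $K_t=K[1,t]$ is the complete graph on $t$ vertices, and $H^k$ denotes the direct product of $k$ copies of $H$. $\alpha(G)$ is the maximum size of an independent set of $G$. For $S\subseteq V(G)$, $N[S]$ is the union of $S$ with all neighbors of vertices of $S$; $S$ is irredundant if $N[S\setminus\{v\}]\neq N[S]$ for every $v\in S$. $\mathrm{IR}(G)$ (the upper irredundance number) is the maximum size of an irredundant set in $G$. -}

module Defs where

open import Data.Nat using (ℕ)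
open import Data.Fin using (Fin)
open import Data.Unit using (⊤; tt)
open import Data.Product using (_×_; _,_; Σ; ∃; ∃-syntax)
open import Data.Sum using (_⊎_)
open import Data.List using (List; []; _∷_; length)
open import Data.List.Membership.Propositional using (_∈_; _─_)
open import Data.List.Relation.Unary.Any using (Any)
open import Data.List.Relation.Unary.Unique.Propositional using (Unique)
open import Data.Nat using (_≤_)
open import Relation.Binary.PropositionalEquality using (_≡_; _≢_)
open import Relation.Nullary using (¬_)
open import Function.Bundles using (_↔_; Inverse; _⇔_)

record Graph : Set₁ where
  field
    V   : Set
    Adj : V → V → Set
open Graph public

_≅_ : Graph → Graph → Set
G ≅ H = Σ (V G ↔ V H) λ f →
          ∀ x y → Adj G x y ⇔ Adj H (Inverse.to f x) (Inverse.to f y)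

-- Independent sets, closed neighbourhoods, irredundant sets.
-- Vertex subsets are represented by duplicate-free lists.

Independent : (G : Graph) → List (V G) → Set
Independent G S = Unique S × (∀ {x y} → x ∈ S → y ∈ S → ¬ Adj G x y)

InN : (G : Graph) → List (V G) → V G → Set
InN G S w = Any (λ s → (s ≡ w) ⊎ Adj G s w) S

Irredundant : (G : Graph) → List (V G) → Set
Irredundant G S = Unique S ×
  (∀ {v} (p : v ∈ S) → ¬ (∀ w → InN G (S ─ p) w ⇔ InN G S w))

IsAlpha : Graph → ℕ → Set
IsAlpha G k = (∃[ S ] (Independent G S × length S ≡ k))
            × (∀ S → Independent G S → length S ≤ k)

IsIR : Graph → ℕ → Set
IsIR G k = (∃[ S ] (Irredundant G S × length S ≡ k))
         × (∀ S → Irredundant G S → length S ≤ k)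

-- Balanced complete multipartite graphs and their direct products.
-- A factor K[u,t] is encoded as the pair (u , t); a vertex of K[u,t]
-- is (part , index) ∈ Fin t × Fin u, adjacent iff the parts differ.

KMVert : ℕ × ℕ → Set
KMVert (u , t) = Fin t × Fin u

KMAdj : (p : ℕ × ℕ) → KMVert p → KMVert p → Set
KMAdj _ (a , _) (b , _) = a ≢ b

K[_,_] : ℕ → ℕ → Graph
K[ u , t ] = record { V = KMVert (u , t) ; Adj = KMAdj (u , t) }

-- Direct product of a list of graphs (used for nonempty lists).
ProdV : List Graph → Set
ProdV []       = ⊤
ProdV (G ∷ Gs) = V G × ProdV Gs

ProdAdj : (Gs : List Graph) → ProdV Gs → ProdV Gs → Set
ProdAdj []       _        _        = ⊤
ProdAdj (G ∷ Gs) (x , xs) (y , ys) = Adj G x y × ProdAdj Gs xs ys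

Prod : List Graph → Graph
Prod Gs = record { V = ProdV Gs ; Adj = ProdAdj Gs }

KProd : List (ℕ × ℕ) → Graph
KProd ps = Prod (Data.List.map (λ { (u , t) → K[ u , t ] }) ps)

K : ℕ → ℕ × ℕ
K t = (1 , t)

KM : ℕ → ℕ → ℕ × ℕ
KM u t = (u , t)

exceptions : List (List (ℕ × ℕ))
exceptions =
    (K 3 ∷ K 3 ∷ K 3 ∷ K 3 ∷ [])
  ∷ (KM 2 3 ∷ K 3 ∷ K 3 ∷ K 3 ∷ [])
  ∷ (KM 3 3 ∷ K 3 ∷ K 3 ∷ K 3 ∷ [])
  ∷ (K 4 ∷ K 3 ∷ K 3 ∷ K 3 ∷ [])
  ∷ (KM 2 4 ∷ K 3 ∷ K 3 ∷ K 3 ∷ [])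
  ∷ (K 4 ∷ KM 2 3 ∷ K 3 ∷ K 3 ∷ [])
  ∷ (K 4 ∷ K 4 ∷ K 3 ∷ K 3 ∷ [])
  ∷ (KM 2 4 ∷ K 4 ∷ K 3 ∷ K 3 ∷ [])
  ∷ (K 4 ∷ K 4 ∷ KM 2 3 ∷ K 3 ∷ [])
  ∷ (K 4 ∷ K 4 ∷ K 4 ∷ K 3 ∷ [])
  ∷ (K 5 ∷ K 3 ∷ K 3 ∷ K 3 ∷ [])
  ∷ (KM 2 5 ∷ K 3 ∷ K 3 ∷ K 3 ∷ [])
  ∷ (K 5 ∷ KM 2 3 ∷ K 3 ∷ K 3 ∷ [])
  ∷ (K 5 ∷ K 4 ∷ K 3 ∷ K 3 ∷ [])
  ∷ (K 5 ∷ K 4 ∷ K 4 ∷ K 3 ∷ [])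
  ∷ (K 5 ∷ K 5 ∷ K 3 ∷ K 3 ∷ [])
  ∷ (K 6 ∷ K 3 ∷ K 3 ∷ K 3 ∷ [])
  ∷ (K 6 ∷ K 4 ∷ K 3 ∷ K 3 ∷ [])
  ∷ (K 6 ∷ K 4 ∷ K 4 ∷ K 3 ∷ [])
  ∷ (K 6 ∷ K 5 ∷ K 3 ∷ K 3 ∷ [])
  ∷ (K 7 ∷ K 3 ∷ K 3 ∷ K 3 ∷ [])
  ∷ (K 7 ∷ K 4 ∷ K 3 ∷ K 3 ∷ [])
  ∷ (K 8 ∷ K 3 ∷ K 3 ∷ K 3 ∷ [])
  ∷ (K 8 ∷ K 4 ∷ K 3 ∷ K 3 ∷ [])
  ∷ (K 9 ∷ K 3 ∷ K 3 ∷ K 3 ∷ [])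
  ∷ (K 10 ∷ K 3 ∷ K 3 ∷ K 3 ∷ [])
  ∷ (K 3 ∷ K 3 ∷ K 3 ∷ K 3 ∷ K 3 ∷ [])
  ∷ (KM 2 3 ∷ K 3 ∷ K 3 ∷ K 3 ∷ K 3 ∷ [])
  ∷ (K 4 ∷ K 3 ∷ K 3 ∷ K 3 ∷ K 3 ∷ [])
  ∷ (K 4 ∷ K 4 ∷ K 3 ∷ K 3 ∷ K 3 ∷ [])
  ∷ (K 4 ∷ K 4 ∷ K 4 ∷ K 3 ∷ K 3 ∷ [])
  ∷ (K 5 ∷ K 3 ∷ K 3 ∷ K 3 ∷ K 3 ∷ [])
  ∷ (K 5 ∷ K 4 ∷ K 3 ∷ K 3 ∷ K 3 ∷ [])
  ∷ (K 6 ∷ K 3 ∷ K 3 ∷ K 3 ∷ K 3 ∷ [])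
  ∷ (K 7 ∷ K 3 ∷ K 3 ∷ K 3 ∷ K 3 ∷ [])
  ∷ (K 3 ∷ K 3 ∷ K 3 ∷ K 3 ∷ K 3 ∷ K 3 ∷ [])
  ∷ (K 4 ∷ K 3 ∷ K 3 ∷ K 3 ∷ K 3 ∷ K 3 ∷ [])
  ∷ []

{-# OPTIONS --safe #-}
module Submission where

-- Let t be the least number of parts, σ = t − 1, N = |V| and d the degree. Fixing a part in the
-- coordinate attaining t gives an independent set of size N / t, and independent sets are
-- irredundant, so it suffices to bound an irredundant set b₁, …, bₛ by N / t. Choose private
-- neighbours wᵢ, each equal or adjacent to bᵢ, and let β count the i with wᵢ ≠ bᵢ.
--
-- For t ≥ 3 take x = Σ δ(bᵢ) and y = Σ δ(wᵢ). Then ⟨x , y⟩ = s − β, while privacy leaves only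
-- β adjacent pairs: ⟨x , A y⟩ = β. Since 4⟨x , A y⟩ = ⟨x+y , A(x+y)⟩ − ⟨x−y , A(x−y)⟩ and x − y
-- has mean zero, bounding the first term below by the least eigenvalue −d/σ and the second above
-- by the eigenvalue bound d/σ² gives
--   2 σ d s (t s − N) ≤ β N (2 σ² − (σ − 1) d),
-- which together with β ≤ s forces s ≤ N / t.
--
-- For t = 2, the wᵢ ≠ bᵢ and, for wᵢ = bᵢ, the vertices obtained from bᵢ by moving every
-- coordinate to the next part complete the set to 2 s distinct vertices.

open import Defs
open import Data.Nat.Base as ℕ using (ℕ; zero; suc; NonZero; s≤s; z≤n)
import Data.Nat.Properties as ℕ
open import Data.Nat.Tactic.RingSolver using () renaming (solve-∀ to solve-∀-ℕ)
open import Data.Integer.Base using (ℤ; +_; -[1+_]; -_; _+_; _*_; _-_; _≤_; 0ℤ; 1ℤ; -1ℤ; +≤+)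
import Data.Integer.Properties as ℤ
open import Data.Integer.Tactic.RingSolver using (solve-∀)
open import Algebra.Properties.CommutativeMonoid.Sum ℤ.+-0-commutativeMonoid
  using (sum; sum-cong-≗; ∑-distrib-+)
open import Data.Bool.Base using (if_then_else_)
open import Data.Fin.Base using (Fin; zero; suc; inject₁; fromℕ; combine; splitAt; join)
open import Data.Fin.Properties
  using (_≟_; any?; suc-injective; inject₁-injective; fromℕ≢inject₁; combine-injective;
         injective⇒≤; join-splitAt)
open import Data.Product using (_×_; _,_; proj₁; proj₂; Σ; ∃; ∃-syntax)
open import Data.Sum using (_⊎_; inj₁; inj₂; [_,_]′)
open import Data.Unit using (⊤; tt)
open import Data.List using (List; []; _∷_; length; lookup; map; allFin; cartesianProduct)
open import Data.List.Extrema ℕ.≤-totalOrder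
  using (argmin; argmin-sel; f[argmin]≤f[⊤]; f[argmin]≤f[xs])
open import Data.List.Properties using (length-++; length-map; length-tabulate)
open import Data.List.Membership.Propositional using (_∈_; _∉_; _─_; find; lose)
open import Data.List.Membership.Propositional.Properties using (∈-lookup; ∈-cartesianProduct⁻)
open import Data.List.Relation.Unary.All as All using (All; []; _∷_)
open import Data.List.Relation.Unary.Any as Any using (Any; here; there)
open import Data.List.Relation.Unary.AllPairs using ([]; _∷_)
open import Data.List.Relation.Unary.Unique.Propositional using (Unique)
open import Data.List.Relation.Unary.Unique.Propositional.Properties
  using (cartesianProduct⁺; allFin⁺)
open import Relation.Nullary using (¬_; Dec; yes; no; does; contradiction)
open import Relation.Nullary.Decidable
  using (map′; _×-dec_; _⊎-dec_; ¬?; dec-true; dec-false; decidable-stable)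
open import Relation.Unary using (Decidable)
open import Relation.Binary.PropositionalEquality
  using (_≡_; _≢_; _≗_; refl; sym; trans; cong; cong₂; subst; module ≡-Reasoning)
open import Function.Base using (_∘_)
open import Function.Bundles using (_⇔_; Equivalence; mk⇔)

private variable
  X Y : Set
  n : ℕ
  ps : List (ℕ × ℕ)

-- Arithmetic of nonnegative integers and finite sums

+-nonneg : ∀ {a b} → 0ℤ ≤ a → 0ℤ ≤ b → 0ℤ ≤ a + b
+-nonneg = ℤ.+-mono-≤

*-nonneg : ∀ {a b} → 0ℤ ≤ a → 0ℤ ≤ b → 0ℤ ≤ a * b
*-nonneg {+ a} {+ b} _ _ = subst (0ℤ ≤_) (ℤ.pos-* a b) (+≤+ ℕ.z≤n)

0≤+ : ∀ k → 0ℤ ≤ + k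
0≤+ k = +≤+ ℕ.z≤n

weaken-nonneg : ∀ a b → 0ℤ ≤ b → 0ℤ ≤ a - b → 0ℤ ≤ a
weaken-nonneg a b b≥0 h = subst (0ℤ ≤_) (lem a b) (+-nonneg h b≥0)
  where lem : ∀ a b → a - b + b ≡ a
        lem = solve-∀

positive⇒nonneg : ∀ a → 0ℤ ≤ a - 1ℤ → 0ℤ ≤ a
positive⇒nonneg a = weaken-nonneg a 1ℤ (0≤+ 1)

positive-* : ∀ a b → 0ℤ ≤ a - 1ℤ → 0ℤ ≤ b - 1ℤ → 0ℤ ≤ a * b - 1ℤ
positive-* a b a>0 b>0 = subst (0ℤ ≤_) (lem a b) (+-nonneg (+-nonneg (*-nonneg a>0 b>0) a>0) b>0)
  where lem : ∀ a b → (a - 1ℤ) * (b - 1ℤ) + (a - 1ℤ) + (b - 1ℤ) ≡ a * b - 1ℤ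
        lem = solve-∀

halve : ∀ {a} → 0ℤ ≤ + 2 * a → 0ℤ ≤ a
halve {a} = ℤ.*-cancelˡ-≤-pos 0ℤ a (+ 2)

square-nonneg : ∀ a → 0ℤ ≤ a * a
square-nonneg (+ k)        = *-nonneg (0≤+ k) (0≤+ k)
square-nonneg -[1+ k ]    = 0≤+ _

sum-nonneg : (f : Fin n → ℤ) → (∀ i → 0ℤ ≤ f i) → 0ℤ ≤ sum f
sum-nonneg {zero}  f h = ℤ.≤-refl
sum-nonneg {suc _} f h = +-nonneg (h zero) (sum-nonneg (f ∘ suc) (h ∘ suc))

sum-zero : (f : Fin n → ℤ) → (∀ i → f i ≡ 0ℤ) → sum f ≡ 0ℤ
sum-zero {zero}  f h = refl
sum-zero {suc _} f h = cong₂ _+_ (h zero) (sum-zero (f ∘ suc) (h ∘ suc))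

sum-const : ∀ n c → sum {n} (λ _ → c) ≡ + n * c
sum-const zero    c = sym (ℤ.*-zeroˡ c)
sum-const (suc n) c = trans (cong (_+_ c) (sum-const n c)) (sym (lem (+ n) c))
  where lem : ∀ n c → (1ℤ + n) * c ≡ c + n * c
        lem = solve-∀

sum-single : (f : Fin n → ℤ) (i : Fin n) → (∀ j → j ≢ i → f j ≡ 0ℤ) → sum f ≡ f i
sum-single f zero    h =
  trans (cong (_+_ (f zero)) (sum-zero (f ∘ suc) λ j → h (suc j) λ ())) (ℤ.+-identityʳ _)
sum-single f (suc i) h =
  trans (cong₂ _+_ (h zero λ ())
                   (sum-single (f ∘ suc) i λ j j≢i → h (suc j) λ { refl → j≢i refl }))
        (ℤ.+-identityˡ _)

sum-linear : ∀ a b (f g : Fin n → ℤ) →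
             sum (λ i → a * f i + b * g i) ≡ a * sum f + b * sum g
sum-linear {zero}  a b f g = sym (lem a b)
  where lem : ∀ a b → a * 0ℤ + b * 0ℤ ≡ 0ℤ
        lem = solve-∀
sum-linear {suc _} a b f g =
  trans (cong (_+_ (a * f zero + b * g zero)) (sum-linear a b (f ∘ suc) (g ∘ suc)))
        (lem a b (f zero) (g zero) _ _)
  where lem : ∀ a b x y s t → a * x + b * y + (a * s + b * t) ≡ a * (x + s) + b * (y + t)
        lem = solve-∀

-- Symmetric bilinear forms on integer-valued functions

infixl 6 _⊕_ _⊖_

_⊕_ _⊖_ : (X → ℤ) → (X → ℤ) → X → ℤ
(f ⊕ g) x = f x + g x
(f ⊖ g) x = f x - g x

∑ᶠ : (Fin n → X → ℤ) → X → ℤ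
∑ᶠ v x = sum λ i → v i x

record Additive (X Y : Set) : Set where
  field
    apply      : (X → ℤ) → Y → ℤ
    apply-cong : ∀ {f g} → f ≗ g → apply f ≗ apply g
    apply-add  : ∀ f g → apply (f ⊕ g) ≗ apply f ⊕ apply g

-- Additivity and symmetry suffice over the integers: differences and the zero function are handled
-- by cancellation. `pair-cong` makes a form respect pointwise equality in place of function
-- extensionality.
record Form (X : Set) : Set where
  field
    pair : (X → ℤ) → (X → ℤ) → ℤ
    pair-cong : ∀ {f f′ g g′} → f ≗ f′ → g ≗ g′ → pair f g ≡ pair f′ g′
    pair-sym  : ∀ f g → pair f g ≡ pair g f
    pair-add  : ∀ f g h → pair (f ⊕ g) h ≡ pair f h + pair g h

open Form

quad : Form X → (X → ℤ) → ℤ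
quad B f = pair B f f

PSD : Form X → Set
PSD B = ∀ f → 0ℤ ≤ quad B f

pointForm : Form ⊤
pointForm = record
  { pair = λ f g → f tt * g tt
  ; pair-cong = λ p q → cong₂ _*_ (p tt) (q tt)
  ; pair-sym  = λ f g → ℤ.*-comm (f tt) (g tt)
  ; pair-add  = λ f g h → ℤ.*-distribʳ-+ (h tt) (f tt) (g tt)
  }

comb : ℤ → Form X → ℤ → Form X → Form X
comb a B b C = record
  { pair = λ f g → a * pair B f g + b * pair C f g
  ; pair-cong = λ p q → cong₂ (λ x y → a * x + b * y) (pair-cong B p q) (pair-cong C p q)
  ; pair-sym  = λ f g → cong₂ (λ x y → a * x + b * y) (pair-sym B f g) (pair-sym C f g)
  ; pair-add  = λ f g h → trans (cong₂ (λ x y → a * x + b * y) (pair-add B f g h) (pair-add C f g h))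
                           (lem a b (pair B f h) (pair B g h) (pair C f h) (pair C g h))
  }
  where lem : ∀ a b x y z w → a * (x + y) + b * (z + w) ≡ a * x + b * z + (a * y + b * w)
        lem = solve-∀

sumForm : (Fin n → Form X) → Form X
sumForm B = record
  { pair = λ f g → sum λ i → pair (B i) f g
  ; pair-cong = λ p q → sum-cong-≗ λ i → pair-cong (B i) p q
  ; pair-sym  = λ f g → sum-cong-≗ λ i → pair-sym (B i) f g
  ; pair-add  = λ f g h → trans (sum-cong-≗ λ i → pair-add (B i) f g h)
                           (∑-distrib-+ (λ i → pair (B i) f h) (λ i → pair (B i) g h))
  }

pull : Additive X Y → Form Y → Form X
pull ℓ B = record
  { pair = λ f g → pair B (apply f) (apply g)
  ; pair-cong = λ p q → pair-cong B (apply-cong p) (apply-cong q)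
  ; pair-sym  = λ f g → pair-sym B (apply f) (apply g)
  ; pair-add  = λ f g h → trans (pair-cong B (apply-add f g) λ _ → refl) (pair-add B (apply f) (apply g) (apply h))
  }
  where open Additive ℓ

module _ (B : Form X) where

  pair-addʳ : ∀ f g h → pair B f (g ⊕ h) ≡ pair B f g + pair B f h
  pair-addʳ f g h = trans (pair-sym B f (g ⊕ h)) (trans (pair-add B g h f)
    (cong₂ _+_ (pair-sym B g f) (pair-sym B h f)))

  pair-subˡ : ∀ f g h → pair B (f ⊖ g) h ≡ pair B f h - pair B g h
  pair-subˡ f g h = trans (lem₁ (pair B (f ⊖ g) h) (pair B g h))
    (cong (_- pair B g h) (trans (sym (pair-add B (f ⊖ g) g h))
                                 (pair-cong B (λ x → lem₂ (f x) (g x)) λ _ → refl)))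
    where lem₁ : ∀ a b → a ≡ a + b - b
          lem₁ = solve-∀
          lem₂ : ∀ a b → a - b + b ≡ a
          lem₂ = solve-∀

  pair-subʳ : ∀ f g h → pair B f (g ⊖ h) ≡ pair B f g - pair B f h
  pair-subʳ f g h = trans (pair-sym B f (g ⊖ h)) (trans (pair-subˡ g h f)
    (cong₂ _-_ (pair-sym B g f) (pair-sym B h f)))

  -- A zero function agrees pointwise with `f ⊖ f`, so additivity alone determines the value.
  pair-zeroˡ : ∀ {f} g → (∀ x → f x ≡ 0ℤ) → pair B f g ≡ 0ℤ
  pair-zeroˡ {f} g f≡0 = trans (pair-cong B (λ x → trans (f≡0 x) (sym (ℤ.+-inverseʳ (f x)))) λ _ → refl)
                               (trans (pair-subˡ f f g) (ℤ.+-inverseʳ (pair B f g)))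

  pair-∑ˡ : (v : Fin n → X → ℤ) → ∀ g → pair B (∑ᶠ v) g ≡ sum λ i → pair B (v i) g
  pair-∑ˡ {zero}  v g = pair-zeroˡ g λ _ → refl
  pair-∑ˡ {suc _} v g = trans (pair-add B (v zero) (∑ᶠ (v ∘ suc)) g)
    (cong (_+_ (pair B (v zero) g)) (pair-∑ˡ (v ∘ suc) g))

  pair-∑ : ∀ {m} (v : Fin m → X → ℤ) (w : Fin n → X → ℤ) →
           pair B (∑ᶠ v) (∑ᶠ w) ≡ sum λ i → sum λ j → pair B (v i) (w j)
  pair-∑ v w = trans (pair-∑ˡ v _) (sum-cong-≗ λ i →
    trans (pair-sym B (v i) (∑ᶠ w)) (trans (pair-∑ˡ w (v i))
          (sum-cong-≗ λ j → pair-sym B (w j) (v i))))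

  quad-⊕ : ∀ f g → quad B (f ⊕ g) ≡ quad B f + + 2 * pair B f g + quad B g
  quad-⊕ f g = trans (pair-add B f g (f ⊕ g))
    (trans (cong₂ _+_ (pair-addʳ f f g) (trans (pair-addʳ g f g) (cong (_+ quad B g) (pair-sym B g f))))
           (lem (quad B f) (pair B f g) (quad B g)))
    where lem : ∀ a b c → a + b + (b + c) ≡ a + + 2 * b + c
          lem = solve-∀

  quad-⊖ : ∀ f g → quad B (f ⊖ g) ≡ quad B f - + 2 * pair B f g + quad B g
  quad-⊖ f g = trans (pair-subˡ f g (f ⊖ g))
    (trans (cong₂ _-_ (pair-subʳ f f g) (trans (pair-subʳ g f g) (cong (_- quad B g) (pair-sym B g f))))
           (lem (quad B f) (pair B f g) (quad B g)))
    where lem : ∀ a b c → a - b - (b - c) ≡ a - + 2 * b + c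
          lem = solve-∀

  module _ (psd : PSD B) where

    -- Expand the sum over i of `quad B (w ⊖ v i)`, whose terms are all nonnegative.
    cross-bound : ∀ w (v : Fin n → X → ℤ) →
      0ℤ ≤ + n * quad B w + sum (λ i → quad B (v i)) - + 2 * pair B w (∑ᶠ v)
    cross-bound {zero} w v = ℤ.≤-reflexive (trans (lem (quad B w))
      (cong (λ z → 0ℤ * quad B w + 0ℤ - + 2 * z)
            (sym (trans (pair-sym B w (∑ᶠ v)) (pair-zeroˡ w λ _ → refl)))))
      where lem : ∀ a → 0ℤ ≡ 0ℤ * a + 0ℤ - + 2 * 0ℤ
            lem = solve-∀
    cross-bound {suc n} w v = subst (0ℤ ≤_) eq
      (+-nonneg (subst (0ℤ ≤_) (quad-⊖ w (v zero)) (psd (w ⊖ v zero))) (cross-bound w (v ∘ suc)))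
      where
      lem : ∀ n a b c s p → a - + 2 * b + c + (n * a + s - + 2 * p)
                          ≡ (1ℤ + n) * a + (c + s) - + 2 * (b + p)
      lem = solve-∀
      eq = trans (lem (+ n) (quad B w) (pair B w (v zero)) (quad B (v zero)) _ _)
                 (cong (λ z → + suc n * quad B w + sum (λ i → quad B (v i)) - + 2 * z)
                       (sym (pair-addʳ w (v zero) (∑ᶠ (v ∘ suc)))))

    -- The difference is the sum of `quad B (v i ⊖ v j)` over pairs i < j. Each induction step adds
    -- the pairs that contain the new function.
    jensen : (v : Fin n → X → ℤ) → 0ℤ ≤ + n * sum (λ i → quad B (v i)) - quad B (∑ᶠ v)
    jensen {zero} v = ℤ.≤-reflexive (sym (cong (λ z → 0ℤ - z) (pair-zeroˡ (∑ᶠ v) λ _ → refl)))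
    jensen {suc n} v = subst (0ℤ ≤_) eq
      (+-nonneg (cross-bound (v zero) (v ∘ suc)) (jensen (v ∘ suc)))
      where
      lem : ∀ n a s p q → n * a + s - + 2 * p + (n * s - q)
                        ≡ (1ℤ + n) * (a + s) - (a + + 2 * p + q)
      lem = solve-∀
      eq = trans (lem (+ n) (quad B (v zero)) _ _ _)
                 (cong (λ z → + suc n * sum (λ i → quad B (v i)) - z)
                       (sym (quad-⊕ (v zero) (∑ᶠ (v ∘ suc)))))

jensen-comb : ∀ a (B : Form X) b (C : Form X) → PSD (comb a B b C) → (v : Fin n → X → ℤ) →
  0ℤ ≤ + n * (a * sum (λ i → quad B (v i)) + b * sum (λ i → quad C (v i)))
       - (a * quad B (∑ᶠ v) + b * quad C (∑ᶠ v))
jensen-comb {n = n} a B b C psd v =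
  subst (λ z → 0ℤ ≤ + n * z - (a * quad B (∑ᶠ v) + b * quad C (∑ᶠ v)))
        (sum-linear a b (λ i → quad B (v i)) (λ i → quad C (v i))) (jensen (comb a B b C) psd v)

-- The adjacency form of a product of complete multipartite graphs

Vertex : List (ℕ × ℕ) → Set
Vertex ps = V (KProd ps)

_~_ : ∀ {ps} → Vertex ps → Vertex ps → Set
_~_ {ps} = Adj (KProd ps)

slice : ∀ u t {ps} → Fin t → Fin u → Additive (Vertex ((u , t) ∷ ps)) (Vertex ps)
slice u t p i = record
  { apply      = λ f x → f ((p , i) , x)
  ; apply-cong = λ h x → h _
  ; apply-add  = λ f g x → refl
  }

part : ∀ u t {ps} → Fin t → Additive (Vertex ((u , t) ∷ ps)) (Vertex ps)
part u t p = record
  { apply      = λ f → ∑ᶠ λ i x → f ((p , i) , x)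
  ; apply-cong = λ h x → sum-cong-≗ λ i → h ((p , i) , x)
  ; apply-add  = λ f g x → ∑-distrib-+ (λ i → f ((p , i) , x)) (λ i → g ((p , i) , x))
  }

whole : ∀ u t {ps} → Additive (Vertex ((u , t) ∷ ps)) (Vertex ps)
whole u t {ps} = record
  { apply      = λ f → ∑ᶠ λ p → Additive.apply (part u t {ps} p) f
  ; apply-cong = λ h x → sum-cong-≗ λ p → Additive.apply-cong (part u t {ps} p) h x
  ; apply-add  = λ f g x → trans (sum-cong-≗ λ p → Additive.apply-add (part u t {ps} p) f g x)
    (∑-distrib-+ (λ p → Additive.apply (part u t {ps} p) f x) (λ p → Additive.apply (part u t {ps} p) g x))
  }

-- A factor K[u,t] joins exactly the pairs in different parts, so `adjForm` is the form of the total
-- over all parts minus the forms of the totals over single parts. `dotForm` is the inner product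
-- and `massForm` the product of the total masses. The empty product is one vertex with a loop.
adjForm dotForm massForm : ∀ ps → Form (Vertex ps)

adjForm []             = pointForm
adjForm ((u , t) ∷ ps) =
  comb 1ℤ (pull (whole u t {ps}) (adjForm ps)) -1ℤ (sumForm λ p → pull (part u t {ps} p) (adjForm ps))

dotForm []             = pointForm
dotForm ((u , t) ∷ ps) = sumForm λ p → sumForm λ i → pull (slice u t {ps} p i) (dotForm ps)

massForm []             = pointForm
massForm ((u , t) ∷ ps) = pull (whole u t {ps}) (massForm ps)

card degree : List (ℕ × ℕ) → ℤ
card   []             = 1ℤ
card   ((u , t) ∷ ps) = + u * + t * card ps
degree []             = 1ℤ
degree ((u , t) ∷ ps) = + u * (+ t - 1ℤ) * degree ps

dot-psd : ∀ ps → PSD (dotForm ps)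
dot-psd []             f = square-nonneg (f tt)
dot-psd ((u , t) ∷ ps) f = sum-nonneg {t} _ λ p → sum-nonneg {u} _ λ i → dot-psd ps _

mass-psd : ∀ ps → PSD (massForm ps)
mass-psd []             f = square-nonneg (f tt)
mass-psd ((u , t) ∷ ps) f = mass-psd ps _

-- Two-sided spectral gap of the adjacency form

Large : ℤ → List (ℕ × ℕ) → Set
Large σ = All λ p → 0ℤ ≤ + proj₂ p - 1ℤ - σ

Large⇒ : ∀ {σ σ′ ps} → σ′ ≤ σ → Large σ ps → Large σ′ ps
Large⇒ le []       = []
Large⇒ {σ} {σ′} le (_∷_ {x = u , t} h hs) =
  subst (0ℤ ≤_) (lem (+ t) σ σ′) (+-nonneg h (ℤ.i≤j⇒0≤j-i le)) ∷ Large⇒ le hs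
  where lem : ∀ t a b → t - 1ℤ - a + (a - b) ≡ t - 1ℤ - b
        lem = solve-∀

card-nonneg : ∀ ps → 0ℤ ≤ card ps
card-nonneg []             = 0≤+ 1
card-nonneg ((u , t) ∷ ps) = *-nonneg (*-nonneg (0≤+ u) (0≤+ t)) (card-nonneg ps)

degree-nonneg : ∀ {σ ps} → 0ℤ ≤ σ → Large σ ps → 0ℤ ≤ degree ps
degree-nonneg σ≥0 [] = 0≤+ 1
degree-nonneg {σ} σ≥0 (_∷_ {x = u , t} h hs) =
  *-nonneg (*-nonneg (0≤+ u) (weaken-nonneg (+ t - 1ℤ) σ σ≥0 h)) (degree-nonneg σ≥0 hs)

-- The adjacency eigenvalues other than the degree d lie in [−d/σ, d/σ²].
lowerGap upperGap : ℤ → ∀ ps → (Vertex ps → ℤ) → ℤ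
lowerGap σ ps f = σ * card ps * quad (adjForm ps) f + degree ps * card ps * quad (dotForm ps) f
                - degree ps * (σ + 1ℤ) * quad (massForm ps) f
upperGap σ ps f = degree ps * card ps * quad (dotForm ps) f
                + (σ * σ - 1ℤ) * degree ps * quad (massForm ps) f
                - σ * σ * card ps * quad (adjForm ps) f

-- Induction on the factors. The new factor K[u,t] has the negative eigenvalue -u, which exchanges
-- the two sides: the lower bound needs an upper bound on the remaining factors, and conversely. The
-- upper bound used is the trivial one by the degree, which is the case σ = 1; this is why σ is kept
-- general.
spectral-gap : ∀ {σ} ps → 1ℤ ≤ σ → Large σ ps → ∀ f →
               0ℤ ≤ lowerGap σ ps f × 0ℤ ≤ upperGap σ ps f
spectral-gap {σ} [] _ _ f =
  ℤ.≤-reflexive (lem₁ σ (f tt * f tt)) , ℤ.≤-reflexive (lem₂ σ (f tt * f tt))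
  where
  lem₁ : ∀ σ a → 0ℤ ≡ σ * 1ℤ * a + 1ℤ * 1ℤ * a - 1ℤ * (σ + 1ℤ) * a
  lem₁ = solve-∀
  lem₂ : ∀ σ a → 0ℤ ≡ 1ℤ * 1ℤ * a + (σ * σ - 1ℤ) * 1ℤ * a - σ * σ * 1ℤ * a
  lem₂ = solve-∀
spectral-gap {σ} ((u , t) ∷ ps) 1≤σ (h ∷ hs) f =
  -- Four nonnegative terms: the gap of the total `G`, the spread between parts of a form that is
  -- semidefinite by induction, Cauchy-Schwarz within the parts, and the surplus t - 1 - σ times the
  -- spread of the inner product between parts. The upper gap has the same shape.
  (subst (0ℤ ≤_) (lower (+ u) (+ t) σ N d A P G₂ P₂ g₂ l)
    (*-nonneg (0≤+ u)
      (+-nonneg (+-nonneg (+-nonneg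
        (*-nonneg t-1≥0 (proj₁ (spectral-gap ps 1≤σ hs G)))
        (*-nonneg σ≥0 (jensen-comb (d * N) IP (- N) Q upper₁ Gₚ)))
        (*-nonneg (*-nonneg (0≤+ t) (*-nonneg t-1≥0 dN≥0)) fibres))
        (*-nonneg (*-nonneg h dN≥0) (jensen IP (dot-psd ps) Gₚ))))) ,
  (subst (0ℤ ≤_) (upper (+ u) (+ t) σ N d A P G₂ P₂ g₂ l)
    (*-nonneg (0≤+ u)
      (+-nonneg (+-nonneg (+-nonneg
        (*-nonneg t-1≥0 (proj₂ (spectral-gap ps 1≤σ hs G)))
        (*-nonneg σ≥0 (jensen-comb (d * N) IP (σ * N) Q lower₁ Gₚ)))
        (*-nonneg (*-nonneg (0≤+ t) (*-nonneg t-1≥0 dN≥0)) fibres))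
        (*-nonneg (*-nonneg h dN≥0) (jensen IP (dot-psd ps) Gₚ)))))
  where
  N = card ps
  d = degree ps
  Q = adjForm ps
  IP = dotForm ps
  Gₚ : Fin t → Vertex ps → ℤ
  Gₚ p = Additive.apply (part u t {ps} p) f
  G = ∑ᶠ Gₚ
  A = quad Q G
  P = sum λ p → quad Q (Gₚ p)
  G₂ = quad IP G
  P₂ = sum λ p → quad IP (Gₚ p)
  g₂ = quad (dotForm ((u , t) ∷ ps)) f
  l = quad (massForm ps) G

  σ≥0 : 0ℤ ≤ σ
  σ≥0 = ℤ.≤-trans (0≤+ 1) 1≤σ

  dN≥0 : 0ℤ ≤ d * N
  dN≥0 = *-nonneg (degree-nonneg σ≥0 hs) (card-nonneg ps)

  t-1≥0 : 0ℤ ≤ + t - 1ℤ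
  t-1≥0 = weaken-nonneg (+ t - 1ℤ) σ σ≥0 h

  -- Every eigenvalue is at most d: this is the upper gap at σ = 1, where the mass term vanishes.
  upper₁ : PSD (comb (d * N) IP (- N) Q)
  upper₁ g = subst (0ℤ ≤_) (lem d N (quad IP g) (quad (massForm ps) g) (quad Q g))
    (proj₂ (spectral-gap ps ℤ.≤-refl (Large⇒ 1≤σ hs) g))
    where lem : ∀ d N a b c → d * N * a + (1ℤ * 1ℤ - 1ℤ) * d * b - 1ℤ * 1ℤ * N * c
                            ≡ d * N * a + - N * c
          lem = solve-∀

  -- Every eigenvalue is at least -d/σ: the mass term subtracted in the lower gap is nonnegative and
  -- may be added back.
  lower₁ : PSD (comb (d * N) IP (σ * N) Q)
  lower₁ g = subst (0ℤ ≤_) (lem d N σ (quad IP g) (quad (massForm ps) g) (quad Q g))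
    (+-nonneg (proj₁ (spectral-gap ps 1≤σ hs g))
              (*-nonneg (*-nonneg (degree-nonneg σ≥0 hs) (+-nonneg σ≥0 (0≤+ 1))) (mass-psd ps g)))
    where lem : ∀ d N σ a b c → σ * N * c + d * N * a - d * (σ + 1ℤ) * b + d * (σ + 1ℤ) * b
                              ≡ d * N * a + σ * N * c
          lem = solve-∀

  fibres : 0ℤ ≤ + u * g₂ - P₂
  fibres = subst (0ℤ ≤_)
    (trans (sum-cong-≗ λ p → lem₁ (+ u) (sum λ i → quad IP (λ x → f ((p , i) , x))) (quad IP (Gₚ p)))
           (trans (sum-linear (+ u) -1ℤ (λ p → sum λ i → quad IP (λ x → f ((p , i) , x)))
                                        (λ p → quad IP (Gₚ p)))
                  (lem₂ (+ u) g₂ P₂)))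
    (sum-nonneg {t} _ λ p → jensen IP (dot-psd ps) λ i x → f ((p , i) , x))
    where lem₁ : ∀ u a b → u * a - b ≡ u * a + -1ℤ * b
          lem₁ = solve-∀
          lem₂ : ∀ u a b → u * a + -1ℤ * b ≡ u * a - b
          lem₂ = solve-∀

  lower : ∀ u t σ N d A P G₂ P₂ g₂ l →
    u * ((t - 1ℤ) * (σ * N * A + d * N * G₂ - d * (σ + 1ℤ) * l)
       + (σ * (t * (d * N * P₂ + - N * P) - (d * N * G₂ + - N * A)))
       + t * ((t - 1ℤ) * (d * N)) * (u * g₂ - P₂)
       + ((t - 1ℤ - σ) * (d * N) * (t * P₂ - G₂)))
    ≡ (σ * (u * t * N) * (1ℤ * A + -1ℤ * P) + u * (t - 1ℤ) * d * (u * t * N) * g₂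
             - u * (t - 1ℤ) * d * (σ + 1ℤ) * l)
  lower = solve-∀

  upper : ∀ u t σ N d A P G₂ P₂ g₂ l →
    u * ((t - 1ℤ) * (d * N * G₂ + (σ * σ - 1ℤ) * d * l - σ * σ * N * A)
       + (σ * (t * (d * N * P₂ + σ * N * P) - (d * N * G₂ + σ * N * A)))
       + t * ((t - 1ℤ) * (d * N)) * (u * g₂ - P₂)
       + ((t - 1ℤ - σ) * (d * N) * (t * P₂ - G₂)))
    ≡ (u * (t - 1ℤ) * d * (u * t * N) * g₂ + (σ * σ - 1ℤ) * (u * (t - 1ℤ) * d) * l
             - σ * σ * (u * t * N) * (1ℤ * A + -1ℤ * P))
  upper = solve-∀

-- Point masses and the values of the three forms on them

χ : Fin n → Fin n → ℤ
χ p q = if does (p ≟ q) then 1ℤ else 0ℤ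

χ-refl : (p : Fin n) → χ p p ≡ 1ℤ
χ-refl p rewrite dec-true (p ≟ p) refl = refl

χ-≢ : {p q : Fin n} → p ≢ q → χ p q ≡ 0ℤ
χ-≢ {p = p} {q} p≢q rewrite dec-false (p ≟ q) p≢q = refl

-- A product of Kronecker symbols, one coordinate at a time, so that its slices, part sums and total
-- are each zero or again a point mass on the remaining factors.
δ : ∀ ps → Vertex ps → Vertex ps → ℤ
δ []             _             _             = 1ℤ
δ ((u , t) ∷ ps) ((p , i) , x) ((q , j) , y) = χ p q * (χ i j * δ ps x y)

module _ {u t ps} (p : Fin t) (i : Fin u) (x : Vertex ps) where

  private
    δₓ = δ ((u , t) ∷ ps) ((p , i) , x)

  slice-δ : Additive.apply (slice u t {ps} p i) δₓ ≗ δ ps x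
  slice-δ y rewrite χ-refl p | χ-refl i = trans (ℤ.*-identityˡ _) (ℤ.*-identityˡ _)

  slice-δ-≢ˡ : ∀ {q} j → p ≢ q → ∀ y → Additive.apply (slice u t {ps} q j) δₓ y ≡ 0ℤ
  slice-δ-≢ˡ j p≢q y rewrite χ-≢ p≢q = ℤ.*-zeroˡ (χ i j * δ ps x y)

  slice-δ-≢ʳ : ∀ q {j} → i ≢ j → ∀ y → Additive.apply (slice u t {ps} q j) δₓ y ≡ 0ℤ
  slice-δ-≢ʳ q i≢j y rewrite χ-≢ i≢j = trans (cong (χ p q *_) (ℤ.*-zeroˡ (δ ps x y))) (ℤ.*-zeroʳ (χ p q))

  part-δ : Additive.apply (part u t {ps} p) δₓ ≗ δ ps x
  part-δ y = trans (sum-single _ i λ j j≢i → slice-δ-≢ʳ p (j≢i ∘ sym) y) (slice-δ y)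

  part-δ-≢ : ∀ {q} → p ≢ q → ∀ y → Additive.apply (part u t {ps} q) δₓ y ≡ 0ℤ
  part-δ-≢ p≢q y = sum-zero {u} _ λ j → slice-δ-≢ˡ j p≢q y

  whole-δ : Additive.apply (whole u t {ps}) δₓ ≗ δ ps x
  whole-δ y = trans (sum-single {t} _ p λ q q≢p → part-δ-≢ (q≢p ∘ sym) y) (part-δ y)

pair-zeroʳ : (B : Form X) → ∀ f {g} → (∀ x → g x ≡ 0ℤ) → pair B f g ≡ 0ℤ
pair-zeroʳ B f g≡0 = trans (pair-sym B f _) (pair-zeroˡ B f g≡0)

mass-δ : ∀ ps x y → pair (massForm ps) (δ ps x) (δ ps y) ≡ 1ℤ
mass-δ []             _             _             = refl
mass-δ ((u , t) ∷ ps) ((p , i) , x) ((q , j) , y) =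
  trans (pair-cong (massForm ps) (whole-δ p i x) (whole-δ q j y)) (mass-δ ps x y)

dot-δ-refl : ∀ ps x → pair (dotForm ps) (δ ps x) (δ ps x) ≡ 1ℤ
dot-δ-refl []             _             = refl
dot-δ-refl ((u , t) ∷ ps) ((p , i) , x) =
  trans (sum-single {t} _ p λ q q≢p → sum-zero {u} _ λ j →
           pair-zeroˡ (dotForm ps) _ (slice-δ-≢ˡ p i x j (q≢p ∘ sym)))
  (trans (sum-single {u} _ i λ j j≢i → pair-zeroˡ (dotForm ps) _ (slice-δ-≢ʳ p i x p (j≢i ∘ sym)))
  (trans (pair-cong (dotForm ps) (slice-δ p i x) (slice-δ p i x)) (dot-δ-refl ps x)))

dot-δ-≢ : ∀ ps {x y} → x ≢ y → pair (dotForm ps) (δ ps x) (δ ps y) ≡ 0ℤ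
dot-δ-≢ []             x≢y = contradiction refl x≢y
dot-δ-≢ ((u , t) ∷ ps) {(p , i) , x} {(q , j) , y} x≢y = sum-zero {t} _ λ r → sum-zero {u} _ λ k →
  entry r k (p ≟ r) (i ≟ k) (q ≟ r) (j ≟ k)
  where
  D = dotForm ps
  entry : ∀ r k → Dec (p ≡ r) → Dec (i ≡ k) → Dec (q ≡ r) → Dec (j ≡ k) →
    pair (pull (slice u t {ps} r k) D) (δ ((u , t) ∷ ps) ((p , i) , x))
                                       (δ ((u , t) ∷ ps) ((q , j) , y)) ≡ 0ℤ
  entry r k (no p≢r) _ _ _ = pair-zeroˡ D _ (slice-δ-≢ˡ p i x k p≢r)
  entry r k _ (no i≢k) _ _ = pair-zeroˡ D _ (slice-δ-≢ʳ p i x r i≢k)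
  entry r k _ _ (no q≢r) _ = pair-zeroʳ D _ (slice-δ-≢ˡ q j y k q≢r)
  entry r k _ _ _ (no j≢k) = pair-zeroʳ D _ (slice-δ-≢ʳ q j y r j≢k)
  entry r k (yes refl) (yes refl) (yes refl) (yes refl) =
    trans (pair-cong D (slice-δ p i x) (slice-δ p i y)) (dot-δ-≢ ps λ { refl → x≢y refl })

private
  part-pair-≢ : ∀ {u t} ps {p q : Fin t} (i j : Fin u) x y → p ≢ q → ∀ r → Dec (p ≡ r) →
    pair (pull (part u t {ps} r) (adjForm ps)) (δ ((u , t) ∷ ps) ((p , i) , x))
                                               (δ ((u , t) ∷ ps) ((q , j) , y)) ≡ 0ℤ
  part-pair-≢ ps {p} {q} i j x y p≢q r (no p≢r)   = pair-zeroˡ (adjForm ps) _ (part-δ-≢ p i x p≢r)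
  part-pair-≢ ps {p} {q} i j x y p≢q r (yes refl) = pair-zeroʳ (adjForm ps) _ (part-δ-≢ q j y (p≢q ∘ sym))

  1a-0 : ∀ a → 1ℤ * a + -1ℤ * 0ℤ ≡ a
  1a-0 = solve-∀

  1a-a : ∀ a → 1ℤ * a + -1ℤ * a ≡ 0ℤ
  1a-a = solve-∀

-- No single part meets both points, so the subtracted sum over parts vanishes.
adj-δ-≢ : ∀ {u t} ps {p q : Fin t} (i j : Fin u) x y → p ≢ q →
  pair (adjForm ((u , t) ∷ ps)) (δ _ ((p , i) , x)) (δ _ ((q , j) , y))
    ≡ pair (adjForm ps) (δ ps x) (δ ps y)
adj-δ-≢ {u} {t} ps {p} {q} i j x y p≢q =
  trans (cong₂ (λ a b → 1ℤ * a + -1ℤ * b)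
               (pair-cong (adjForm ps) (whole-δ p i x) (whole-δ q j y))
               (sum-zero {t} _ (λ r → part-pair-≢ ps i j x y p≢q r (p ≟ r))))
        (1a-0 (pair (adjForm ps) (δ ps x) (δ ps y)))

-- Only the common part contributes to the subtracted sum, and it cancels the total.
adj-δ-≡ : ∀ {u t} ps (p : Fin t) (i j : Fin u) x y →
  pair (adjForm ((u , t) ∷ ps)) (δ _ ((p , i) , x)) (δ _ ((p , j) , y)) ≡ 0ℤ
adj-δ-≡ {u} {t} ps p i j x y =
  trans (cong₂ (λ a b → 1ℤ * a + -1ℤ * b)
               (pair-cong (adjForm ps) (whole-δ p i x) (whole-δ p j y))
               (trans (sum-single {t} _ p λ r r≢p → pair-zeroˡ (adjForm ps) _ (part-δ-≢ p i x (r≢p ∘ sym)))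
                      (pair-cong (adjForm ps) (part-δ p i x) (part-δ p j y))))
        (1a-a (pair (adjForm ps) (δ ps x) (δ ps y)))

adj-δ-~ : ∀ ps {x y} → x ~ y → pair (adjForm ps) (δ ps x) (δ ps y) ≡ 1ℤ
adj-δ-~ []             _ = refl
adj-δ-~ ((u , t) ∷ ps) {(p , i) , x} {(q , j) , y} (p≢q , x~y) =
  trans (adj-δ-≢ ps i j x y p≢q) (adj-δ-~ ps x~y)

adj-δ-≁ : ∀ ps {x y} → ¬ x ~ y → pair (adjForm ps) (δ ps x) (δ ps y) ≡ 0ℤ
adj-δ-≁ []             x≁y = contradiction tt x≁y
adj-δ-≁ ((u , t) ∷ ps) {(p , i) , x} {(q , j) , y} x≁y with p ≟ q
... | yes refl = adj-δ-≡ ps p i j x y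
... | no p≢q   = trans (adj-δ-≢ ps i j x y p≢q) (adj-δ-≁ ps λ x~y → x≁y (p≢q , x~y))

-- Families with private neighbours and the arithmetic of the bound

~-sym : ∀ ps {x y} → _~_ {ps} x y → _~_ {ps} y x
~-sym []       _          = tt
~-sym (_ ∷ ps) (p≢q , x~y) = p≢q ∘ sym , ~-sym ps x~y

record PrivateNeighbours (ps : List (ℕ × ℕ)) (s : ℕ) : Set where
  field
    b w  : Fin s → Vertex ps
    b-inj : ∀ {i j} → b i ≡ b j → i ≡ j
    hit  : ∀ i → b i ≡ w i ⊎ _~_ {ps} (b i) (w i)
    miss : ∀ {i j} → i ≢ j → b i ≢ w j × ¬ _~_ {ps} (b i) (w j)

  -- Otherwise `b i` would reach `w j` by `hit`, which `miss` forbids.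
  w-inj : ∀ {i j} → w i ≡ w j → i ≡ j
  w-inj {i} {j} eq with i ≟ j | hit i
  ... | yes i≡j | _         = i≡j
  ... | no i≢j  | inj₁ bi≡wi = contradiction (trans bi≡wi eq) (proj₁ (miss i≢j))
  ... | no i≢j  | inj₂ bi~wi = contradiction (subst (_~_ {ps} (b i)) eq bi~wi) (proj₂ (miss i≢j))

-- With N = t k and d = (t − 1) e, the argument for t ≥ 3 only needs k − e < k e / 4.
record Balanced (e k : ℤ) : Set where
  constructor balanced
  field
    e>0 : 0ℤ ≤ e - 1ℤ
    k≥0 : 0ℤ ≤ k
    gap : 0ℤ ≤ k * e - + 4 * k + + 4 * e - 1ℤ

-- Scaling multiplies the product `k * e` by u² but the linear terms only by u.
balanced-scale : ∀ u {e k} → 0ℤ ≤ u - 1ℤ → Balanced e k → Balanced (u * e) (u * k)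
balanced-scale u {e} {k} u>0 (balanced e>0 k≥0 bal) =
  balanced (positive-* u e u>0 e>0) (*-nonneg u≥0 k≥0) (subst (0ℤ ≤_) (lem u e k)
    (+-nonneg (+-nonneg (*-nonneg u≥0 bal)
                        (*-nonneg (*-nonneg u≥0 u>0) (*-nonneg k≥0 (positive⇒nonneg e e>0)))) u>0))
  where
  u≥0 = positive⇒nonneg u u>0
  lem : ∀ u e k → u * (k * e - + 4 * k + + 4 * e - 1ℤ) + u * (u - 1ℤ) * (k * e) + (u - 1ℤ)
                ≡ u * k * (u * e) - + 4 * (u * k) + + 4 * (u * e) - 1ℤ
  lem = solve-∀

-- Compared with t - 1 times the old gap, the new one gains (t - 1)² k e and loses 4 k. Since (t -
-- 1)² = (t - 3)(t + 1) + 4 and e ≥ 1, the gain covers the loss as soon as t ≥ 3.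
balanced-grow : ∀ t {e k} → 0ℤ ≤ t - 1ℤ - + 2 → Balanced e k → Balanced ((t - 1ℤ) * e) (t * k)
balanced-grow t {e} {k} t≥3 (balanced e>0 k≥0 bal) =
  balanced (positive-* (t - 1ℤ) e t-1>0 e>0) (*-nonneg (positive⇒nonneg t t-1≥0) k≥0)
    (subst (0ℤ ≤_) (lem t e k)
    (+-nonneg (+-nonneg (*-nonneg t-1≥0 bal)
      (*-nonneg k≥0 (+-nonneg (*-nonneg (*-nonneg t≥3 (+-nonneg t-1≥0 (0≤+ 2))) (positive⇒nonneg e e>0))
                              (*-nonneg (0≤+ 4) e>0))))
      t-1>0))
  where
  t-1>0 : 0ℤ ≤ t - 1ℤ - 1ℤ
  t-1>0 = subst (0ℤ ≤_) (lem t) (+-nonneg t≥3 (0≤+ 1))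
    where lem : ∀ t → t - 1ℤ - + 2 + 1ℤ ≡ t - 1ℤ - 1ℤ
          lem = solve-∀
  t-1≥0 = positive⇒nonneg (t - 1ℤ) t-1>0
  lem : ∀ t e k → (t - 1ℤ) * (k * e - + 4 * k + + 4 * e - 1ℤ)
                  + k * ((t - 1ℤ - + 2) * (t - 1ℤ + + 2) * e + + 4 * (e - 1ℤ)) + (t - 1ℤ - 1ℤ)
                ≡ t * k * ((t - 1ℤ) * e) - + 4 * (t * k) + + 4 * ((t - 1ℤ) * e) - 1ℤ
  lem = solve-∀

-- With r = s − k − 1 ≥ 0 the spectral inequality reads 0 ≤ −c W with c, W > 0.
spectral-contradiction : ∀ σ e k s α r qx qy → 0ℤ ≤ σ - + 2 → Balanced e k →
  0ℤ ≤ α → 0ℤ ≤ s - α → 0ℤ ≤ r → s ≡ k + 1ℤ + r →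
  ¬ 0ℤ ≤ σ * (σ * ((σ + 1ℤ) * k) * (qx + + 2 * (s - α) + qy)
              + σ * e * ((σ + 1ℤ) * k) * (s + + 2 * α + s)
              - σ * e * (σ + 1ℤ) * (s * s + + 2 * (s * s) + s * s))
         + (σ * e * ((σ + 1ℤ) * k) * (s - + 2 * α + s)
            + (σ * σ - 1ℤ) * (σ * e) * (s * s - + 2 * (s * s) + s * s)
            - σ * σ * ((σ + 1ℤ) * k) * (qx - + 2 * (s - α) + qy))
spectral-contradiction σ e k s α r qx qy σ≥2 (balanced e>0 k≥0 bal) α≥0 β≥0 r≥0 refl h =
  -- The quantity in `h` equals -2σ(σ + 1) W, with `qx` and `qy` cancelling. Adding the nonnegative
  -- 2σ(σ + 1) W - 1 leaves -1.
  contradiction (subst (0ℤ ≤_) (eq σ e k α r qx qy)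
    (+-nonneg h (positive-* (+ 2 * σ * (σ + 1ℤ)) W c>0 W>0))) λ ()
  where
  -- `a₀ + 1` and `a₁ + 1` are the coefficients of α and of s - α in W. Splitting one unit off each
  -- collects the summand s = k + 1 + r, which makes W positive.
  a₀ = + 2 * σ * e * (1ℤ + r) - 1ℤ
  a₁ = + 2 * σ * e * (1ℤ + r) + (σ - 1ℤ) * k * e - + 2 * σ * k - 1ℤ
  W  = (s - α) * a₁ + α * a₀ + s

  e≥0 : 0ℤ ≤ e
  e≥0 = positive⇒nonneg e e>0

  σ>0 : 0ℤ ≤ σ - 1ℤ
  σ>0 = subst (0ℤ ≤_) (lem σ) (+-nonneg σ≥2 (0≤+ 1))
    where lem : ∀ σ → σ - + 2 + 1ℤ ≡ σ - 1ℤ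
          lem = solve-∀

  σ≥0 : 0ℤ ≤ σ
  σ≥0 = positive⇒nonneg σ σ>0

  c>0 : 0ℤ ≤ + 2 * σ * (σ + 1ℤ) - 1ℤ
  c>0 = positive-* (+ 2 * σ) (σ + 1ℤ) (positive-* (+ 2) σ (0≤+ 1) σ>0) (subst (0ℤ ≤_) (lem σ) σ≥0)
    where lem : ∀ σ → σ ≡ σ + 1ℤ - 1ℤ
          lem = solve-∀

  a₀≥0 : 0ℤ ≤ a₀
  a₀≥0 = positive-* (+ 2 * σ * e) (1ℤ + r) (positive-* (+ 2 * σ) e (positive-* (+ 2) σ (0≤+ 1) σ>0) e>0)
    (subst (0ℤ ≤_) (lem r) r≥0)
    where lem : ∀ r → r ≡ 1ℤ + r - 1ℤ
          lem = solve-∀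

  a₁≥0 : 0ℤ ≤ a₁
  -- Twice `a₁` is σ times `gap` plus terms that are nonnegative because σ ≥ 2; the doubling
  -- accounts for the 4 in `gap`.
  a₁≥0 = halve (subst (0ℤ ≤_) (lem σ e k r)
    (+-nonneg (+-nonneg (+-nonneg (*-nonneg σ≥0 bal) σ≥2) (*-nonneg σ≥2 (*-nonneg k≥0 e≥0)))
              (*-nonneg (*-nonneg (*-nonneg (0≤+ 4) σ≥0) e≥0) r≥0)))
    where lem : ∀ σ e k r → σ * (k * e - + 4 * k + + 4 * e - 1ℤ) + (σ - + 2)
                            + (σ - + 2) * (k * e) + + 4 * σ * e * r
                          ≡ + 2 * (+ 2 * σ * e * (1ℤ + r) + (σ - 1ℤ) * k * e - + 2 * σ * k - 1ℤ)
          lem = solve-∀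

  W>0 : 0ℤ ≤ W - 1ℤ
  W>0 = subst (0ℤ ≤_) (lem ((s - α) * a₁ + α * a₀) k r)
    (+-nonneg (+-nonneg (*-nonneg β≥0 a₁≥0) (*-nonneg α≥0 a₀≥0)) (+-nonneg k≥0 r≥0))
    where lem : ∀ a k r → a + (k + r) ≡ a + (k + 1ℤ + r) - 1ℤ
          lem = solve-∀

  eq : ∀ σ e k α r qx qy → let s = k + 1ℤ + r in
       σ * (σ * ((σ + 1ℤ) * k) * (qx + + 2 * (s - α) + qy)
            + σ * e * ((σ + 1ℤ) * k) * (s + + 2 * α + s)
            - σ * e * (σ + 1ℤ) * (s * s + + 2 * (s * s) + s * s))
       + (σ * e * ((σ + 1ℤ) * k) * (s - + 2 * α + s)
          + (σ * σ - 1ℤ) * (σ * e) * (s * s - + 2 * (s * s) + s * s)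
          - σ * σ * ((σ + 1ℤ) * k) * (qx - + 2 * (s - α) + qy))
       + (+ 2 * σ * (σ + 1ℤ) * ((s - α) * (+ 2 * σ * e * (1ℤ + r) + (σ - 1ℤ) * k * e - + 2 * σ * k - 1ℤ)
            + α * (+ 2 * σ * e * (1ℤ + r) - 1ℤ) + s) - 1ℤ)
       ≡ -1ℤ
  eq = solve-∀

-- The spectral bound on families with private neighbours

module _ {ps s} (P : PrivateNeighbours ps s) where
  open PrivateNeighbours P

  private
    x y : Vertex ps → ℤ
    x = ∑ᶠ (δ ps ∘ b)
    y = ∑ᶠ (δ ps ∘ w)

    diagonal : (B : Form (Vertex ps)) (f g : Fin s → Vertex ps) →
      (∀ i j → j ≢ i → pair B (δ ps (f i)) (δ ps (g j)) ≡ 0ℤ) →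
      pair B (∑ᶠ (δ ps ∘ f)) (∑ᶠ (δ ps ∘ g)) ≡ sum λ i → pair B (δ ps (f i)) (δ ps (g i))
    diagonal B f g h = trans (pair-∑ B (δ ps ∘ f) (δ ps ∘ g))
                             (sum-cong-≗ {s} λ i → sum-single {s} _ i (h i))

    dot-inj : (f : Fin s → Vertex ps) → (∀ {i j} → f i ≡ f j → i ≡ j) →
              quad (dotForm ps) (∑ᶠ (δ ps ∘ f)) ≡ + s
    dot-inj f inj =
      trans (diagonal (dotForm ps) f f λ i j j≢i → dot-δ-≢ ps λ eq → j≢i (sym (inj eq)))
      (trans (sum-cong-≗ {s} λ i → dot-δ-refl ps (f i)) (trans (sum-const s 1ℤ) (ℤ.*-identityʳ (+ s))))

    mass-fam : (f g : Fin s → Vertex ps) →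
               pair (massForm ps) (∑ᶠ (δ ps ∘ f)) (∑ᶠ (δ ps ∘ g)) ≡ + s * + s
    mass-fam f g =
      trans (pair-∑ (massForm ps) (δ ps ∘ f) (δ ps ∘ g))
      (trans (sum-cong-≗ {s} λ i → trans (sum-cong-≗ {s} λ j → mass-δ ps (f i) (g j))
                                         (trans (sum-const s 1ℤ) (ℤ.*-identityʳ (+ s))))
             (sum-const s (+ s)))

    a c : Fin s → ℤ
    a i = pair (dotForm ps) (δ ps (b i)) (δ ps (w i))
    c i = pair (adjForm ps) (δ ps (b i)) (δ ps (w i))

  -- The two gaps are applied to the sum and the difference of the indicator functions `x` and `y`.
  -- Irreflexivity ensures that each i is counted in exactly one of the pairings `pair D x y` and
  -- `pair Q x y`.
  spectral-bound : ∀ {σ e k} → (∀ v → ¬ _~_ {ps} v v) → 0ℤ ≤ σ - + 2 → Large σ ps →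
    degree ps ≡ σ * e → card ps ≡ (σ + 1ℤ) * k → Balanced e k → + s ≤ k
  spectral-bound {σ} {e} {k} irrefl σ≥2 large deg crd bal with + s ℤ.≤? k
  ... | yes s≤k = s≤k
  ... | no s≰k = contradiction ineq
        (spectral-contradiction σ e k (+ s) α (+ s - (1ℤ + k)) (quad Q x) (quad Q y)
          σ≥2 bal α≥0 β≥0 (ℤ.i≤j⇒0≤j-i (ℤ.i<j⇒suc[i]≤j (ℤ.≰⇒> s≰k))) (lem (+ s) k))
    where
    lem : ∀ s k → s ≡ k + 1ℤ + (s - (1ℤ + k))
    lem = solve-∀

    Q = adjForm ps
    D = dotForm ps
    M = massForm ps
    α = sum a

    -- `a i` is 1 if `b i ≡ w i` and 0 otherwise, and `c i` is its complement, written in the shape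
    -- that `sum-linear` produces. Hence α counts the i with `b i ≡ w i`, and `+ s - α` is the
    -- number β of the overview.
    01-values : ∀ i → 0ℤ ≤ a i × c i ≡ 1ℤ * 1ℤ + -1ℤ * a i × 0ℤ ≤ 1ℤ * 1ℤ + -1ℤ * a i
    01-values i with hit i
    ... | inj₁ b≡w rewrite sym b≡w | dot-δ-refl ps (b i) | adj-δ-≁ ps (irrefl (b i)) =
      0≤+ 1 , refl , 0≤+ 0
    ... | inj₂ b~w rewrite dot-δ-≢ ps {b i} {w i}
                                   (λ eq → irrefl (w i) (subst (λ z → _~_ {ps} z (w i)) eq b~w))
                         | adj-δ-~ ps b~w = 0≤+ 0 , refl , 0≤+ 1

    rest : sum (λ i → 1ℤ * 1ℤ + -1ℤ * a i) ≡ + s - α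
    rest = trans (sum-linear {s} 1ℤ -1ℤ (λ _ → 1ℤ) a)
                 (trans (cong (λ z → 1ℤ * z + -1ℤ * α) (sum-const s 1ℤ)) (lem′ (+ s) α))
      where lem′ : ∀ s α → 1ℤ * (s * 1ℤ) + -1ℤ * α ≡ s - α
            lem′ = solve-∀

    α≥0 : 0ℤ ≤ α
    α≥0 = sum-nonneg a λ i → proj₁ (01-values i)

    β≥0 : 0ℤ ≤ + s - α
    β≥0 = subst (0ℤ ≤_) rest (sum-nonneg {s} _ λ i → proj₂ (proj₂ (01-values i)))

    Dxy : pair D x y ≡ α
    Dxy = diagonal D b w λ i j j≢i → dot-δ-≢ ps (proj₁ (miss (j≢i ∘ sym)))

    Qxy : pair Q x y ≡ + s - α
    Qxy = trans (diagonal Q b w λ i j j≢i → adj-δ-≁ ps (proj₂ (miss (j≢i ∘ sym))))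
                (trans (sum-cong-≗ {s} λ i → proj₁ (proj₂ (01-values i))) rest)

    polar⁺ : (B : Form (Vertex ps)) → ∀ {p q r} → quad B x ≡ p → pair B x y ≡ q → quad B y ≡ r →
             quad B (x ⊕ y) ≡ p + + 2 * q + r
    polar⁺ B refl refl refl = quad-⊕ B x y

    polar⁻ : (B : Form (Vertex ps)) → ∀ {p q r} → quad B x ≡ p → pair B x y ≡ q → quad B y ≡ r →
             quad B (x ⊖ y) ≡ p - + 2 * q + r
    polar⁻ B refl refl refl = quad-⊖ B x y

    σ>0 : 0ℤ ≤ σ - 1ℤ
    σ>0 = subst (0ℤ ≤_) (lem′ σ) (+-nonneg σ≥2 (0≤+ 1))
      where lem′ : ∀ σ → σ - + 2 + 1ℤ ≡ σ - 1ℤ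
            lem′ = solve-∀

    gaps = spectral-gap ps (ℤ.0≤i-j⇒j≤i σ>0) large

    cong₅ : ∀ {d d′ n n′ q q′ i i′ m m′} (F : ℤ → ℤ → ℤ → ℤ → ℤ → ℤ) →
            d ≡ d′ → n ≡ n′ → q ≡ q′ → i ≡ i′ → m ≡ m′ → 0ℤ ≤ F d n q i m → 0ℤ ≤ F d′ n′ q′ i′ m′
    cong₅ F refl refl refl refl refl h = h

    lower = cong₅ (λ d n q i m → σ * n * q + d * n * i - d * (σ + 1ℤ) * m) deg crd
      (polar⁺ Q refl Qxy refl) (polar⁺ D (dot-inj b b-inj) Dxy (dot-inj w w-inj))
      (polar⁺ M (mass-fam b b) (mass-fam b w) (mass-fam w w)) (proj₁ (gaps (x ⊕ y)))

    -- The mass term of `x ⊖ y` is s² - 2 s² + s², which is zero; it stays expanded to match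
    -- `polar⁻`.
    upper = cong₅ (λ d n q i m → d * n * i + (σ * σ - 1ℤ) * d * m - σ * σ * n * q) deg crd
      (polar⁻ Q refl Qxy refl) (polar⁻ D (dot-inj b b-inj) Dxy (dot-inj w w-inj))
      (polar⁻ M (mass-fam b b) (mass-fam b w) (mass-fam w w)) (proj₂ (gaps (x ⊖ y)))

    -- The weight σ gives both adjacency terms the coefficient σ² N up to sign, so `quad Q x` and
    -- `quad Q y` will cancel and only the cross term `pair Q x y` survives.
    ineq = +-nonneg (*-nonneg {σ} (positive⇒nonneg σ σ>0) lower) upper

-- Decidability and counting on the finite vertex set

_≟ᵛ_ : ∀ {ps} (x y : Vertex ps) → Dec (x ≡ y)
_≟ᵛ_ {[]}     _             _             = yes refl
_≟ᵛ_ {_ ∷ ps} ((p , i) , x) ((q , j) , y) =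
  map′ (λ { (refl , refl , refl) → refl }) (λ { refl → refl , refl , refl })
       (p ≟ q ×-dec i ≟ j ×-dec _≟ᵛ_ {ps} x y)

_~?_ : ∀ {ps} (x y : Vertex ps) → Dec (_~_ {ps} x y)
_~?_ {[]}     _             _             = yes tt
_~?_ {_ ∷ ps} ((p , _) , x) ((q , _) , y) = ¬? (p ≟ q) ×-dec _~?_ {ps} x y

-- Irredundance is a negated statement; exhaustive search is what extracts an actual private
-- neighbour from it.
anyᵛ? : ∀ ps {P : Vertex ps → Set} → Decidable P → Dec (∃ P)
anyᵛ? []       P? = map′ (tt ,_) proj₂ (P? tt)
anyᵛ? (_ ∷ ps) P? =
  map′ (λ { (p , i , x , h) → ((p , i) , x) , h }) (λ { (((p , i) , x) , h) → p , i , x , h })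
       (any? λ p → any? λ i → anyᵛ? ps λ x → P? ((p , i) , x))

order : List (ℕ × ℕ) → ℕ
order []             = 1
order ((u , t) ∷ ps) = t ℕ.* u ℕ.* order ps

pos-order : ∀ u t k → + u * (+ t * + k) ≡ + (t ℕ.* u ℕ.* k)
pos-order u t k = begin
  + u * (+ t * + k)   ≡⟨ lem (+ u) (+ t) (+ k) ⟩
  + t * + u * + k     ≡⟨ cong (_* + k) (ℤ.pos-* t u) ⟨
  + (t ℕ.* u) * + k   ≡⟨ ℤ.pos-* (t ℕ.* u) k ⟨
  + (t ℕ.* u ℕ.* k)   ∎
  where open ≡-Reasoning
        lem : ∀ u t k → u * (t * k) ≡ t * u * k
        lem = solve-∀

card-order : ∀ ps → card ps ≡ + order ps
card-order []             = refl
card-order ((u , t) ∷ ps) = trans (ℤ.*-assoc (+ u) (+ t) (card ps))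
  (trans (cong (λ k → + u * (+ t * k)) (card-order ps)) (pos-order u t (order ps)))

index : ∀ ps → Vertex ps → Fin (order ps)
index []       _             = zero
index (_ ∷ ps) ((p , i) , x) = combine (combine p i) (index ps x)

index-injective : ∀ ps {x y} → index ps x ≡ index ps y → x ≡ y
index-injective []       _ = refl
index-injective (_ ∷ ps) {(p , i) , x} {(q , j) , y} eq
  with combine-injective (combine p i) (index ps x) (combine q j) (index ps y) eq
... | eq₁ , eq₂ with combine-injective p i q j eq₁ | index-injective ps eq₂
...   | refl , refl | refl = refl

injective⇒≤order : ∀ ps (f : Fin n → Vertex ps) → (∀ {i j} → f i ≡ f j → i ≡ j) → n ℕ.≤ order ps
injective⇒≤order ps f f-inj = injective⇒≤ {f = index ps ∘ f} (f-inj ∘ index-injective ps)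

disjoint⇒+≤order : ∀ ps {m} (f : Fin m → Vertex ps) (g : Fin n → Vertex ps) →
  (∀ {i j} → f i ≡ f j → i ≡ j) → (∀ {i j} → g i ≡ g j → i ≡ j) → (∀ i j → f i ≢ g j) →
  m ℕ.+ n ℕ.≤ order ps
disjoint⇒+≤order {n} ps {m} f g f-inj g-inj f≢g =
  injective⇒≤order ps (h ∘ splitAt m) λ {i} {j} eq →
    trans (sym (join-splitAt m n i)) (trans (cong (join m n) (h-inj {splitAt m i} {splitAt m j} eq))
                                            (join-splitAt m n j))
  where
  h : Fin m ⊎ Fin n → Vertex ps
  h (inj₁ i) = f i
  h (inj₂ j) = g j

  h-inj : ∀ {i j} → h i ≡ h j → i ≡ j
  h-inj {inj₁ _} {inj₁ _} eq = cong inj₁ (f-inj eq)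
  h-inj {inj₁ i} {inj₂ j} eq = contradiction eq (f≢g i j)
  h-inj {inj₂ j} {inj₁ i} eq = contradiction (sym eq) (f≢g i j)
  h-inj {inj₂ _} {inj₂ _} eq = cong inj₂ (g-inj eq)

-- One factor already excludes loops, whereas the empty product is a single vertex with a loop.
~-irrefl : ps ≢ [] → ∀ v → ¬ _~_ {ps} v v
~-irrefl {[]}    ps≢[] _ _       = ps≢[] refl
~-irrefl {_ ∷ _} _     _ (p≢p , _) = p≢p refl

-- Cyclic rotation of the parts and the doubling argument

rotate : Fin n → Fin n
rotate {suc n} zero    = fromℕ n
rotate {suc n} (suc i) = inject₁ i

rotate-injective : {i j : Fin n} → rotate i ≡ rotate j → i ≡ j
rotate-injective {suc _} {zero}  {zero}  _  = refl
rotate-injective {suc _} {zero}  {suc _} eq = contradiction eq fromℕ≢inject₁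
rotate-injective {suc _} {suc _} {zero}  eq = contradiction (sym eq) fromℕ≢inject₁
rotate-injective {suc _} {suc _} {suc _} eq = cong suc (inject₁-injective eq)

-- The size matters only at `zero`, which goes to the last part: with a single part that would be
-- `zero` itself.
rotate-≢ : 2 ℕ.≤ n → (i : Fin n) → i ≢ rotate i
rotate-≢ (s≤s (s≤s _)) zero    ()
rotate-≢ _               (suc i) = suc≢inject₁ i
  where suc≢inject₁ : ∀ {m} (i : Fin m) → suc i ≢ inject₁ i
        suc≢inject₁ (suc i) eq = suc≢inject₁ i (suc-injective eq)

-- Changing the part in every coordinate pairs each vertex injectively with a neighbour, provided
-- that every factor has at least two parts.
rotateᵛ : ∀ ps → Vertex ps → Vertex ps
rotateᵛ []       _             = tt
rotateᵛ (_ ∷ ps) ((p , i) , x) = (rotate p , i) , rotateᵛ ps x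

rotateᵛ-injective : ∀ ps {x y} → rotateᵛ ps x ≡ rotateᵛ ps y → x ≡ y
rotateᵛ-injective []       _  = refl
rotateᵛ-injective (_ ∷ ps) eq =
  cong₂ _,_ (cong₂ _,_ (rotate-injective (cong (proj₁ ∘ proj₁) eq)) (cong (proj₂ ∘ proj₁) eq))
            (rotateᵛ-injective ps (cong proj₂ eq))

~-rotateᵛ : All (λ p → 2 ℕ.≤ proj₂ p) ps → ∀ x → _~_ {ps} x (rotateᵛ ps x)
~-rotateᵛ []       _             = tt
~-rotateᵛ (h ∷ hs) ((p , _) , x) = rotate-≢ h p , ~-rotateᵛ hs x

private-doubling : ∀ {s} → ps ≢ [] → All (λ p → 2 ℕ.≤ proj₂ p) ps →
                   PrivateNeighbours ps s → s ℕ.+ s ℕ.≤ order ps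
private-doubling {ps} {s} ps≢[] ts≥2 P = disjoint⇒+≤order ps b partner b-inj partner-inj b≢partner
  where
  open PrivateNeighbours P

  data Partner (i : Fin s) (v : Vertex ps) : Set where
    rotated : b i ≡ w i → v ≡ rotateᵛ ps (b i) → Partner i v
    kept    : _~_ {ps} (b i) (w i) → v ≡ w i → Partner i v

  choose : ∀ i → ∃ (Partner i)
  choose i with hit i
  ... | inj₁ b≡w = _ , rotated b≡w refl
  ... | inj₂ b~w = _ , kept b~w refl

  partner : Fin s → Vertex ps
  partner i = proj₁ (choose i)

  joined : ∀ {i v} → Partner i v → _~_ {ps} (b i) v
  joined (rotated _ refl) = ~-rotateᵛ ts≥2 _
  joined (kept b~w refl)  = b~w

  distinct : ∀ {i j v} → i ≢ j → Partner i v → ¬ Partner j v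
  -- Every partner of j is adjacent to `b j`, while a kept partner `w i` is adjacent to no other
  -- `b j`. Two rotated partners are separated by injectivity of the rotation.
  distinct i≢j (kept _ refl)     q                = proj₂ (miss (i≢j ∘ sym)) (joined q)
  distinct i≢j p                 (kept _ refl)    = proj₂ (miss i≢j) (joined p)
  distinct i≢j (rotated _ refl)  (rotated _ eq)   = i≢j (b-inj (rotateᵛ-injective ps eq))

  partner-inj : ∀ {i j} → partner i ≡ partner j → i ≡ j
  partner-inj {i} {j} eq = decidable-stable (i ≟ j) λ i≢j →
    distinct i≢j (proj₂ (choose i)) (subst (Partner j) (sym eq) (proj₂ (choose j)))

  outside : ∀ {i j} → ¬ Partner j (b i)
  outside {i} {j} p with i ≟ j
  ... | yes refl = ~-irrefl ps≢[] (b i) (joined p)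
  outside (kept _ b≡w)    | no i≢j = proj₁ (miss i≢j) b≡w
  -- Here `b j` is its own private neighbour, so it cannot be adjacent to `b i`; yet its rotation is
  -- `b i`.
  outside {i} {j} p@(rotated b≡w _) | no i≢j =
    proj₂ (miss i≢j) (subst (_~_ {ps} (b i)) b≡w (~-sym ps (joined p)))

  b≢partner : ∀ i j → b i ≢ partner j
  b≢partner i j eq = outside (subst (Partner j) (sym eq) (proj₂ (choose j)))

-- Irredundant sets as families with private neighbours

∈-─⁺ : ∀ {xs : List X} {x v} (p : v ∈ xs) → x ∈ xs → x ≢ v → x ∈ xs ─ p
∈-─⁺ (here refl) (here refl) x≢v = contradiction refl x≢v
∈-─⁺ (here refl) (there q)   x≢v = q
∈-─⁺ (there p)   (here eq)   x≢v = here eq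
∈-─⁺ (there p)   (there q)   x≢v = there (∈-─⁺ p q x≢v)

Any-─⁻ : ∀ {P : X → Set} {xs v} (p : v ∈ xs) → Any P (xs ─ p) → Any P xs
Any-─⁻ (here _)  q         = there q
Any-─⁻ (there p) (here h)  = here h
Any-─⁻ (there p) (there q) = there (Any-─⁻ p q)

Unique⇒∉-─ : ∀ {xs : List X} {v} → Unique xs → (p : v ∈ xs) → v ∉ xs ─ p
Unique⇒∉-─ (x∉ ∷ _) (here refl) q          = All.lookup x∉ q refl
Unique⇒∉-─ (x∉ ∷ _) (there p)   (here refl) = All.lookup x∉ p refl
Unique⇒∉-─ (_ ∷ u)  (there p)   (there q)  = Unique⇒∉-─ u p q

Unique⇒lookup-injective : ∀ {xs : List X} → Unique xs → ∀ {i j} → lookup xs i ≡ lookup xs j → i ≡ j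
Unique⇒lookup-injective (_ ∷ _)  {zero}  {zero}  _  = refl
Unique⇒lookup-injective (x∉ ∷ _) {zero}  {suc j} eq = contradiction eq (All.lookup x∉ (∈-lookup j))
Unique⇒lookup-injective (x∉ ∷ _) {suc i} {zero}  eq = contradiction (sym eq) (All.lookup x∉ (∈-lookup i))
Unique⇒lookup-injective (_ ∷ u)  {suc _} {suc _} eq = cong suc (Unique⇒lookup-injective u eq)

-- Each member of an independent set is its own private neighbour: no other member equals it or is
-- adjacent to it.
independent⇒irredundant : ∀ ps {S} → Independent (KProd ps) S → Irredundant (KProd ps) S
independent⇒irredundant ps {S} (uniq , indep) = uniq , λ {v} p same →
  let x , x∈ , x-near = find (Equivalence.from (same v) (lose p (inj₁ refl))) in
  excluded p x∈ x-near
  where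
  excluded : ∀ {v x} (p : v ∈ S) → x ∈ S ─ p → ¬ (x ≡ v ⊎ _~_ {ps} x v)
  excluded p x∈ (inj₁ refl) = Unique⇒∉-─ uniq p x∈
  excluded p x∈ (inj₂ x~v)  = indep (Any-─⁻ p x∈) p x~v

inN? : ∀ ps S w → Dec (InN (KProd ps) S w)
inN? ps S w = Any.any? (λ x → _≟ᵛ_ {ps} x w ⊎-dec _~?_ {ps} x w) S

private-neighbour : ∀ ps {S v} (p : v ∈ S) →
  ¬ (∀ w → InN (KProd ps) (S ─ p) w ⇔ InN (KProd ps) S w) →
  ∃[ w ] (v ≡ w ⊎ _~_ {ps} v w) × (∀ {x} → x ∈ S → x ≢ v → x ≢ w × ¬ _~_ {ps} x w)
private-neighbour ps {S} {v} p changed with anyᵛ? ps (λ w → inN? ps S w ×-dec ¬? (inN? ps (S ─ p) w))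
-- Deleting v can only shrink the closed neighbourhood, so if no vertex is lost the two
-- neighbourhoods agree.
... | no none = contradiction
  (λ w → mk⇔ (Any-─⁻ p) λ q → decidable-stable (inN? ps (S ─ p) w) λ ¬q → none (w , q , ¬q))
  changed
... | yes (w , q , ¬q) = w , near , λ x∈ x≢v → far x∈ x≢v ∘ inj₁ , far x∈ x≢v ∘ inj₂
  where
  far : ∀ {x} → x ∈ S → x ≢ v → ¬ (x ≡ w ⊎ _~_ {ps} x w)
  far x∈ x≢v x-near = ¬q (lose (∈-─⁺ p x∈ x≢v) x-near)

  -- Some member of S reaches w, and by `far` it can only be v.
  near : v ≡ w ⊎ _~_ {ps} v w
  near with find q
  ... | x , x∈ , x-near with _≟ᵛ_ {ps} x v
  ...   | yes refl = x-near
  ...   | no x≢v   = contradiction x-near (far x∈ x≢v)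

privateNeighbours : ∀ ps {S} → Irredundant (KProd ps) S → PrivateNeighbours ps (length S)
privateNeighbours ps {S} (uniq , irr) = record
  { b     = lookup S
  ; w     = λ i → proj₁ (found i)
  ; b-inj = Unique⇒lookup-injective uniq
  ; hit   = λ i → proj₁ (proj₂ (found i))
  ; miss  = λ {i} {j} i≢j →
      proj₂ (proj₂ (found j)) (∈-lookup i) (i≢j ∘ Unique⇒lookup-injective uniq)
  }
  where found = λ (i : Fin (length S)) → private-neighbour ps (∈-lookup {xs = S} i) (irr (∈-lookup i))

-- The vertices with a prescribed part in one coordinate

length-cartesianProduct : (xs : List X) (ys : List Y) →
                          length (cartesianProduct xs ys) ≡ length xs ℕ.* length ys
length-cartesianProduct []       ys = refl
length-cartesianProduct (x ∷ xs) ys = trans (length-++ (map (x ,_) ys))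
  (cong₂ ℕ._+_ (length-map (x ,_) ys) (length-cartesianProduct xs ys))

length-allFin : ∀ n → length (allFin n) ≡ n
length-allFin n = length-tabulate {n = n} λ i → i

vertices : ∀ ps → List (Vertex ps)
vertices []             = tt ∷ []
vertices ((u , t) ∷ ps) = cartesianProduct (cartesianProduct (allFin t) (allFin u)) (vertices ps)

-- The prescribed part is part zero; the empty list at t = 0 keeps the definition total.
first : ∀ t → List (Fin t)
first zero    = []
first (suc _) = zero ∷ []

-- The membership proof marks the coordinate, which the pair alone would not do when a factor is
-- repeated.
star : ∀ {p} → p ∈ ps → List (Vertex ps)
star {(u , t) ∷ ps} (here _)  = cartesianProduct (cartesianProduct (first t) (allFin u)) (vertices ps)
star {(u , t) ∷ ps} (there m) = cartesianProduct (cartesianProduct (allFin t) (allFin u)) (star m)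

vertices-unique : ∀ ps → Unique (vertices ps)
vertices-unique []             = [] ∷ []
vertices-unique ((u , t) ∷ ps) = cartesianProduct⁺ (cartesianProduct⁺ (allFin⁺ t) (allFin⁺ u))
                                                 (vertices-unique ps)

first-unique : ∀ t → Unique (first t)
first-unique zero    = []
first-unique (suc _) = [] ∷ []

first-≡ : ∀ {t} {p q : Fin t} → p ∈ first t → q ∈ first t → p ≡ q
first-≡ {suc _} (here refl) (here refl) = refl

star-independent : ∀ {p} (m : p ∈ ps) → Independent (KProd ps) (star m)
star-independent {(u , t) ∷ ps} (here _) =
  cartesianProduct⁺ (cartesianProduct⁺ (first-unique t) (allFin⁺ u)) (vertices-unique ps) ,
  λ x∈ y∈ (p≢q , _) → p≢q (first-≡ (first-part x∈) (first-part y∈))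
  where
  first-part : ∀ {x} → x ∈ star {(u , t) ∷ ps} {(u , t)} (here refl) → proj₁ (proj₁ x) ∈ first t
  first-part x∈ = proj₁ (∈-cartesianProduct⁻ (first t) (allFin u)
    (proj₁ (∈-cartesianProduct⁻ (cartesianProduct (first t) (allFin u)) (vertices ps) x∈)))
star-independent {(u , t) ∷ ps} (there m) with star-independent m
... | uniq , indep =
  cartesianProduct⁺ (cartesianProduct⁺ (allFin⁺ t) (allFin⁺ u)) uniq ,
  λ x∈ y∈ (_ , x~y) → indep (rest x∈) (rest y∈) x~y
  where
  rest : ∀ {x} → x ∈ star {(u , t) ∷ ps} (there m) → proj₂ x ∈ star m
  rest x∈ = proj₂ (∈-cartesianProduct⁻ (cartesianProduct (allFin t) (allFin u)) (star m) x∈)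

length-vertices : ∀ ps → length (vertices ps) ≡ order ps
length-vertices []             = refl
length-vertices ((u , t) ∷ ps) =
  trans (length-cartesianProduct (cartesianProduct (allFin t) (allFin u)) (vertices ps))
        (cong₂ ℕ._*_ (trans (length-cartesianProduct (allFin t) (allFin u))
                            (cong₂ ℕ._*_ (length-allFin t) (length-allFin u)))
                     (length-vertices ps))

-- The quotient N / t, obtained without division by omitting t at the marked coordinate.
starOrder : ∀ {p} → p ∈ ps → ℕ
starOrder {(u , t) ∷ ps} (here _)  = u ℕ.* order ps
starOrder {(u , t) ∷ ps} (there m) = t ℕ.* u ℕ.* starOrder m

star-length : ∀ {u t} (m : (u , t) ∈ ps) → NonZero t → length (star m) ≡ starOrder m
star-length {ps = (u , zero) ∷ ps}  (here refl) (record { nonZero = () })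
star-length {ps = (u , suc t) ∷ ps} (here refl) _ =
  trans (length-cartesianProduct (cartesianProduct (first (suc t)) (allFin u)) (vertices ps))
        (cong₂ ℕ._*_ (trans (length-cartesianProduct (first (suc t)) (allFin u))
                            (trans (ℕ.*-identityˡ _) (length-allFin u)))
                     (length-vertices ps))
star-length {ps = (u , t) ∷ ps} (there m) nz =
  trans (length-cartesianProduct (cartesianProduct (allFin t) (allFin u)) (star m))
        (cong₂ ℕ._*_ (trans (length-cartesianProduct (allFin t) (allFin u))
                            (cong₂ ℕ._*_ (length-allFin t) (length-allFin u)))
                     (star-length m nz))

order-star : ∀ {u t} (m : (u , t) ∈ ps) → order ps ≡ t ℕ.* starOrder m
order-star {ps = (u , t) ∷ ps} (here refl) = ℕ.*-assoc t u (order ps)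
order-star {ps = (u′ , t′) ∷ ps} {t = t} (there m) =
  trans (cong (t′ ℕ.* u′ ℕ.*_) (order-star m)) (lem t t′ u′ (starOrder m))
  where lem : ∀ t t′ u′ k → t′ ℕ.* u′ ℕ.* (t ℕ.* k) ≡ t ℕ.* (t′ ℕ.* u′ ℕ.* k)
        lem = solve-∀-ℕ

-- The quotient d / (t - 1), obtained by omitting t - 1 at the marked coordinate; it plays the part
-- of e in `Balanced`.
coDegree : ∀ {p} → p ∈ ps → ℤ
coDegree {(u , t) ∷ ps} (here _)  = + u * degree ps
coDegree {(u , t) ∷ ps} (there m) = + u * ((+ t - 1ℤ) * coDegree m)

degree-star : ∀ {u t} (m : (u , t) ∈ ps) → degree ps ≡ (+ t - 1ℤ) * coDegree m
degree-star {ps = (u , t) ∷ ps} (here refl) = lem (+ u) (+ t) (degree ps)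
  where lem : ∀ u t d → u * (t - 1ℤ) * d ≡ (t - 1ℤ) * (u * d)
        lem = solve-∀
degree-star {ps = (u′ , t′) ∷ ps} {t = t} (there m) =
  trans (cong (+ u′ * (+ t′ - 1ℤ) *_) (degree-star m)) (lem (+ u′) (+ t′) (+ t) (coDegree m))
  where lem : ∀ u′ t′ t e → u′ * (t′ - 1ℤ) * ((t - 1ℤ) * e) ≡ (t - 1ℤ) * (u′ * ((t′ - 1ℤ) * e))
        lem = solve-∀

-- Balance of degree and order when every factor has at least three parts

nonZero-pos : ∀ {u} → NonZero u → 0ℤ ≤ + u - 1ℤ
nonZero-pos {suc u} _ = 0≤+ u

NonZeroParts : List (ℕ × ℕ) → Set
NonZeroParts = All λ p → NonZero (proj₁ p)

balanced-factor : ∀ u t {e k} → NonZero u → 0ℤ ≤ + t - 1ℤ - + 2 → Balanced e (+ k) →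
                  Balanced (+ u * ((+ t - 1ℤ) * e)) (+ (t ℕ.* u ℕ.* k))
balanced-factor u t {e} {k} nz t≥3 bal = subst (Balanced _) (pos-order u t k)
  (balanced-scale (+ u) (nonZero-pos nz) (balanced-grow (+ t) t≥3 bal))

balanced-degree : ∀ ps → NonZeroParts ps → Large (+ 2) ps → Balanced (degree ps) (+ order ps)
-- With e = k = 1 the gap is 1 - 4 + 4 - 1 = 0, so the induction starts from equality.
balanced-degree []             _        _            = balanced (0≤+ 0) (0≤+ 1) (0≤+ 0)
balanced-degree ((u , t) ∷ ps) (nz ∷ nzs) (t≥3 ∷ ts≥3) =
  subst (λ e → Balanced e (+ order ((u , t) ∷ ps))) (sym (ℤ.*-assoc (+ u) (+ t - 1ℤ) (degree ps)))
        (balanced-factor u t nz t≥3 (balanced-degree ps nzs ts≥3))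

-- At the marked coordinate t and t - 1 are omitted, so only scaling by u is needed there; all other
-- factors enter in full.
balanced-star : ∀ {p} (m : p ∈ ps) → NonZeroParts ps → Large (+ 2) ps →
                Balanced (coDegree m) (+ starOrder m)
balanced-star {(u , t) ∷ ps} (here _)  (nz ∷ nzs) (_ ∷ ts≥3)   =
  subst (Balanced _) (sym (ℤ.pos-* u (order ps)))
        (balanced-scale (+ u) (nonZero-pos nz) (balanced-degree ps nzs ts≥3))
balanced-star {(u , t) ∷ ps} (there m) (nz ∷ nzs) (t≥3 ∷ ts≥3) =
  balanced-factor u t nz t≥3 (balanced-star m nzs ts≥3)

-- The bound N / t for each least number of parts, and the theorem

private-bound : ∀ {u t s} (m : (u , t) ∈ ps) → ps ≢ [] → NonZeroParts ps → NonZero t →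
                All (λ p → t ℕ.≤ proj₂ p) ps → PrivateNeighbours ps s → s ℕ.≤ starOrder m
-- For t = 1 the quotient N / t is N itself, and injectivity of `b` suffices.
private-bound {ps} {t = 1} m _ _ _ _ P =
  subst (_ ℕ.≤_) (trans (order-star m) (ℕ.*-identityˡ (starOrder m)))
        (injective⇒≤order ps b b-inj)
  where open PrivateNeighbours P
private-bound {ps} {t = 2} {s} m ps≢[] _ _ ts≥t P =
  ℕ.*-cancelˡ-≤ 2 (ℕ.≤-trans (ℕ.≤-reflexive (cong (s ℕ.+_) (ℕ.+-identityʳ s)))
    (ℕ.≤-trans (private-doubling ps≢[] ts≥t P) (ℕ.≤-reflexive (order-star m))))
private-bound {ps} {t = suc (suc (suc t))} {s} m ps≢[] nzs _ ts≥t P =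
  ℤ.drop‿+≤+ (spectral-bound P (~-irrefl ps≢[]) (0≤+ t) large (degree-star m) card-star
    (balanced-star m nzs (Large⇒ (+≤+ (s≤s (s≤s z≤n))) large)))
  where
  -- The least number of parts is `3 + t` in this clause, so σ is `2 + t` and `0≤+ t` above is the
  -- proof of σ ≥ 2.
  σ = + suc (suc t)

  large : Large σ ps
  large = All.map (λ {p} t≤ → subst (0ℤ ≤_) (lem (+ proj₂ p) σ) (ℤ.i≤j⇒0≤j-i (+≤+ t≤))) ts≥t
    where lem : ∀ t σ → t - (1ℤ + σ) ≡ t - 1ℤ - σ
          lem = solve-∀

  card-star : card ps ≡ (σ + 1ℤ) * + starOrder m
  card-star = trans (card-order ps) (trans (cong +_ (order-star m))
    (trans (ℤ.pos-* (3 ℕ.+ t) (starOrder m)) (cong (_* + starOrder m) (ℤ.+-comm 1ℤ σ))))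

minimum-part : ∀ ps → ps ≢ [] → Σ (ℕ × ℕ) λ p → p ∈ ps × All (λ q → proj₂ p ℕ.≤ proj₂ q) ps
minimum-part []       ps≢[] = contradiction refl ps≢[]
minimum-part (p ∷ ps) _     =
  argmin proj₂ p ps ,
  [ here , there ]′ (argmin-sel proj₂ p ps) ,
  f[argmin]≤f[⊤] {f = proj₂} p ps ∷ f[argmin]≤f[xs] {f = proj₂} p ps

theorem1p3 : (ps : List (ℕ × ℕ)) → ¬ (ps ≡ []) →
    All (λ { (u , t) → NonZero u × NonZero t }) ps →
    (∀ H → H ∈ exceptions → ¬ (KProd ps ≅ KProd H)) →
    ∃[ k ] (IsAlpha (KProd ps) k × IsIR (KProd ps) k)
theorem1p3 ps ps≢[] nonZero _ with minimum-part ps ps≢[]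
... | (u , t) , m , t-min =
  -- The star attains both maxima, and the bound on irredundant sets also serves for independent
  -- ones.
  starOrder m ,
  ((star m , indep , star-length m t≢0) , λ S → bound ∘ independent⇒irredundant ps) ,
  ((star m , independent⇒irredundant ps indep , star-length m t≢0) , λ S → bound)
  where
  indep : Independent (KProd ps) (star m)
  indep = star-independent m

  t≢0 : NonZero t
  t≢0 = proj₂ (All.lookup nonZero m)

  bound : ∀ {S} → Irredundant (KProd ps) S → length S ℕ.≤ starOrder m
  bound irr = private-bound m ps≢[] (All.map proj₁ nonZero) t≢0 t-min (privateNeighbours ps irr)
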